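{- For every integer $n\ge 3$, both voting profiles $R_n$ and $\tilde R_n$ (defined in the context) generate the majority graph $G_n=([2^n],E_n)$. Moreover, if $(i,j)\in E_n$, then $i$ precedes $j$ in exactly $2n$ preference lists (rows) of $R_n$, whereas $j$ precedes $i$ in exactly $2n-2$ preference lists of $R_n$.
   Context: For a positive integer $m$, $[m]=\{1,\dots,m\}$. A voting profile on a finite set $V$ of candidates is a matrix each of whose rows (called preference lists, one per voter) is a permutation of the elements of $V$; its size $\#R$ is its number of rows. Candidate $a$ is preferred to $b$ by a voter if $a$ precedes $b$ in the voter's row. The majority graph of $R$ is the directed graph with vertex set $V$ in which $(a,b)$, $a\neq b$, is an arrow if and only if $a$ precedes $b$ in more than half of the rows of $R$; $R$ generates $G$ if $G$ is the majority graph of $R$. Graph $G_3=([8],E_3)$: $E_3$ consists of the 28 arrows $(1,2),(1,3),(1,5),(2,3),(2,4),(2,6),(2,7),$ $(3,4),(3,5),(3,6),(3,8),(4,1),(4,5),(4,8),$ $(5,2),(5,6),(5,7),(6,1),(6,4),(6,7),(6,8),$ $(7,1),(7,3),(7,4),(7,8),(8,1),(8,2),(8,5).$ Graph $G_n=([2^n],E_n)$ for $n\ge 4$: for $q\in[2^{n-3}]$ let $C_q=[8q]\setminus[8(q-1)]$; these classes partition $[2^n]$. For $i,j$ in the same class $C_q$, $(i,j)\in E_n$ if and only if $(i-8(q-1),j-8(q-1))\in E_3$. For $i<j$ in different classes, $(i,j)\in E_n$ if $i+j$ is even, and $(j,i)\in E_n$ if $i+j$ is odd. Profile $R_3$ on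 $[8]$ has the ten rows, in order: $(8,1,5,2,3,4,6,7)$, $(2,7,6,4,1,3,5,8)$, $(2,7,3,6,4,5,8,1)$, $(4,1,3,8,5,6,7,2)$, $(3,5,2,6,7,1,4,8)$, $(6,8,4,1,5,7,2,3)$, $(6,7,3,4,8,1,2,5)$, $(8,5,2,7,1,4,3,6)$, $(7,8,5,6,3,4,1,2)$, $(1,2,3,4,5,6,7,8)$. Operations: for row vectors, $(u_1,\dots,u_N)$ denotes concatenation, and $\bar u$ is $u$ in reverse order. For matrices with the same number of columns, $(M_1,\dots,M_N)_V$ is the matrix obtained by stacking all the rows of $M_1,\dots,M_N$ vertically in this order. $R+a\cdot\boldsymbol{1}$ is $R$ with $a$ added to every entry. For profiles $R^{(1)},R^{(2)}$ on disjoint candidate sets with the same even size $2r$, $R^{(1)}\bowtie R^{(2)}$ is the profile of size $2r$ on the union of the candidate sets whose $s$-th row is $(R^{(1)}_{s,\cdot},R^{(2)}_{s,\cdot})$ for $s$ odd and $(R^{(2)}_{s,\cdot},R^{(1)}_{s,\cdot})$ for $s$ even. For $n\ge 4$ define the vectors (entries in increasing order) $A^{(n)}_1=(1,3,\dots,2^{n-1}-1)$, $B^{(n)}_1=(2^{n-1}+1,2^{n-1}+3,\dots,2^n-1)$, $A^{(n)}_2=(2,4,\dots,2^{n-1})$, $B^{(n)}_2=(2^{n-1}+2,2^{n-1}+4,\dots,2^n)$, and the preference lists $v^{(n)}_1=(A^{(n)}_1,B^{(n)}_1,A^{(n)}_2,B^{(n)}_2)$, $v^{(n)}_2=(\bar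 A^{(n)}_2,\bar B^{(n)}_2,\bar A^{(n)}_1,\bar B^{(n)}_1)$, $v^{(n)}_3=(B^{(n)}_1,A^{(n)}_2,B^{(n)}_2,A^{(n)}_1)$, $v^{(n)}_4=(\bar B^{(n)}_2,\bar A^{(n)}_1,\bar B^{(n)}_1,\bar A^{(n)}_2)$. Recursively, for $n\ge 4$, $$R_n=\Big(v^{(n)}_1,v^{(n)}_2,v^{(n)}_3,v^{(n)}_4,\big[R_{n-1}\bowtie(R_{n-1}+2^{n-1}\cdot\boldsymbol{1})\big]\Big)_V .$$ Thus $\#R_n=4n-2$. For $n\ge3$, $\tilde R_n$ is $R_n$ with its last row deleted, so $\#\tilde R_n=4n-3$. -}

module Defs where

open import Data.Empty using (⊥)
open import Data.List using (List; []; _∷_; _++_; map; reverse; upTo; length; filter; take)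
open import Data.List.Membership.Propositional using (_∈_)
open import Data.List.Relation.Binary.Permutation.Propositional using (_↭_)
open import Data.List.Relation.Binary.Sublist.DecPropositional using (_⊆?_)
open import Data.List.Relation.Unary.All using (All)
open import Data.Nat using (ℕ; suc; _+_; _*_; _∸_; _^_; _≤_; _<_; _≟_)
open import Data.Nat.Divisibility using (_∣_)
open import Data.Product using (_×_; _,_)
open import Function using (_⇔_)
open import Relation.Binary.PropositionalEquality using (_≢_)
open import Relation.Nullary using (¬_)

[1⋯_] : ℕ → List ℕ
[1⋯ m ] = map suc (upTo m)

-- A matrix is the list of its rows.
Row Matrix : Set
Row    = List ℕ
Matrix = List Row

IsProfileOn : List ℕ → Matrix → Set
IsProfileOn V R = All (λ u → u ↭ V) R

# : Matrix → ℕ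
# = length

-- A row of a profile has no repeated entries, so a precedes b in it
-- exactly when (a , b) is a (not necessarily contiguous) subsequence.
#precedes : ℕ → ℕ → Matrix → ℕ
#precedes a b R = length (filter (λ u → _⊆?_ _≟_ (a ∷ b ∷ []) u) R)

record Digraph : Set₁ where
  field
    vertices : List ℕ
    Arrow    : ℕ → ℕ → Set

open Digraph public

majorityGraph : List ℕ → Matrix → Digraph
majorityGraph V R .vertices  = V
majorityGraph V R .Arrow a b = a ∈ V × b ∈ V × a ≢ b × # R < 2 * #precedes a b R

infix 4 _generates_

_generates_ : Matrix → Digraph → Set
R generates G =
  IsProfileOn (vertices G) R ×
  (∀ a b → Arrow G a b ⇔ Arrow (majorityGraph (vertices G) R) a b)

E₃ : List (ℕ × ℕ)
E₃ =
  (1 , 2) ∷ (1 , 3) ∷ (1 , 5) ∷ (2 , 3) ∷ (2 , 4) ∷ (2 , 6) ∷ (2 , 7) ∷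
  (3 , 4) ∷ (3 , 5) ∷ (3 , 6) ∷ (3 , 8) ∷ (4 , 1) ∷ (4 , 5) ∷ (4 , 8) ∷
  (5 , 2) ∷ (5 , 6) ∷ (5 , 7) ∷ (6 , 1) ∷ (6 , 4) ∷ (6 , 7) ∷ (6 , 8) ∷
  (7 , 1) ∷ (7 , 3) ∷ (7 , 4) ∷ (7 , 8) ∷ (8 , 1) ∷ (8 , 2) ∷ (8 , 5) ∷ []

infix 4 _∈C_

-- i ∈C q  means  i ∈ [8q] \ [8(q-1)].
_∈C_ : ℕ → ℕ → Set
i ∈C q = 8 * (q ∸ 1) < i × i ≤ 8 * q

data Arrow≥4 (n : ℕ) : ℕ → ℕ → Set where
  sameClass : ∀ {q i j} → q ∈ [1⋯ 2 ^ (n ∸ 3) ] → i ∈C q → j ∈C q →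
              (i ∸ 8 * (q ∸ 1) , j ∸ 8 * (q ∸ 1)) ∈ E₃ → Arrow≥4 n i j
  evenSum   : ∀ {p q i j} → p ∈ [1⋯ 2 ^ (n ∸ 3) ] → q ∈ [1⋯ 2 ^ (n ∸ 3) ] → p ≢ q →
              i ∈C p → j ∈C q → i < j → 2 ∣ i + j → Arrow≥4 n i j
  oddSum    : ∀ {p q i j} → p ∈ [1⋯ 2 ^ (n ∸ 3) ] → q ∈ [1⋯ 2 ^ (n ∸ 3) ] → p ≢ q →
              i ∈C p → j ∈C q → i < j → ¬ 2 ∣ i + j → Arrow≥4 n j i

-- Here and in the recursion for R, the values at n < 3 are placeholders.
E : ℕ → ℕ → ℕ → Set
E 0 _ _ = ⊥
E 1 _ _ = ⊥
E 2 _ _ = ⊥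
E 3 i j = (i , j) ∈ E₃
E n@(suc (suc (suc (suc _)))) i j = Arrow≥4 n i j

G : ℕ → Digraph
G n .vertices = [1⋯ 2 ^ n ]
G n .Arrow    = E n

R₃ : Matrix
R₃ =
  (8 ∷ 1 ∷ 5 ∷ 2 ∷ 3 ∷ 4 ∷ 6 ∷ 7 ∷ []) ∷
  (2 ∷ 7 ∷ 6 ∷ 4 ∷ 1 ∷ 3 ∷ 5 ∷ 8 ∷ []) ∷
  (2 ∷ 7 ∷ 3 ∷ 6 ∷ 4 ∷ 5 ∷ 8 ∷ 1 ∷ []) ∷
  (4 ∷ 1 ∷ 3 ∷ 8 ∷ 5 ∷ 6 ∷ 7 ∷ 2 ∷ []) ∷
  (3 ∷ 5 ∷ 2 ∷ 6 ∷ 7 ∷ 1 ∷ 4 ∷ 8 ∷ []) ∷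
  (6 ∷ 8 ∷ 4 ∷ 1 ∷ 5 ∷ 7 ∷ 2 ∷ 3 ∷ []) ∷
  (6 ∷ 7 ∷ 3 ∷ 4 ∷ 8 ∷ 1 ∷ 2 ∷ 5 ∷ []) ∷
  (8 ∷ 5 ∷ 2 ∷ 7 ∷ 1 ∷ 4 ∷ 3 ∷ 6 ∷ []) ∷
  (7 ∷ 8 ∷ 5 ∷ 6 ∷ 3 ∷ 4 ∷ 1 ∷ 2 ∷ []) ∷
  (1 ∷ 2 ∷ 3 ∷ 4 ∷ 5 ∷ 6 ∷ 7 ∷ 8 ∷ []) ∷ []

infixl 6 _+𝟏·_

_+𝟏·_ : Matrix → ℕ → Matrix
R +𝟏· a = map (map (_+ a)) R

infixl 5 _⋈_

-- Only used for profiles of equal even size; the last clause otherwise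
-- discards unmatched rows.
_⋈_ : Matrix → Matrix → Matrix
(u₁ ∷ u₂ ∷ R) ⋈ (w₁ ∷ w₂ ∷ S) = (u₁ ++ w₁) ∷ (w₂ ++ u₂) ∷ (R ⋈ S)
_             ⋈ _             = []

A₁ A₂ B₁ B₂ : ℕ → Row
A₁ n = map (λ k → 2 * k + 1) (upTo (2 ^ (n ∸ 2)))
A₂ n = map (λ k → 2 * k + 2) (upTo (2 ^ (n ∸ 2)))
B₁ n = map (λ k → 2 ^ (n ∸ 1) + (2 * k + 1)) (upTo (2 ^ (n ∸ 2)))
B₂ n = map (λ k → 2 ^ (n ∸ 1) + (2 * k + 2)) (upTo (2 ^ (n ∸ 2)))

v₁ v₂ v₃ v₄ : ℕ → Row
v₁ n = A₁ n ++ B₁ n ++ A₂ n ++ B₂ n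
v₂ n = reverse (A₂ n) ++ reverse (B₂ n) ++ reverse (A₁ n) ++ reverse (B₁ n)
v₃ n = B₁ n ++ A₂ n ++ B₂ n ++ A₁ n
v₄ n = reverse (B₂ n) ++ reverse (A₁ n) ++ reverse (B₁ n) ++ reverse (A₂ n)

R : ℕ → Matrix
R 0 = []
R 1 = []
R 2 = []
R 3 = R₃
R n@(suc m@(suc (suc (suc _)))) =
  v₁ n ∷ v₂ n ∷ v₃ n ∷ v₄ n ∷ (R m ⋈ (R m +𝟏· 2 ^ m))

R̃ : ℕ → Matrix
R̃ n = take (# (R n) ∸ 1) (R n)

{-# OPTIONS --safe #-}

-- Let H = 2ⁿ⁻¹ and split [2ⁿ] into the lower half [H] and the upper half.
-- Within one half, each of the two orders of a pair occurs in exactly two of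
-- v₁, …, v₄, and the bowtie contributes what Rₙ₋₁ does, so both counts grow by
-- two.  For i in the lower and j in the upper half, the bowtie splits its rows
-- evenly, and v₁, …, v₄ split 3 : 1 for i when i + j is even and 1 : 3 when it
-- is odd.  Every arrow thus wins by two rows, which survives the loss of one.
module Submission where

open import Defs
open import Data.List using (List; []; _∷_; _++_; map; reverse; upTo; applyUpTo; length; take)
open import Data.List.Membership.Propositional using (_∈_)
open import Data.List.Membership.Propositional.Properties using (∈-map⁺; ∈-map⁻; ∈-upTo⁺; ∈-upTo⁻; ∈-++⁺ˡ; ∈-++⁺ʳ; ∈-++⁻)
open import Data.List.Properties using (filter-accept; filter-reject; map-++; map-∘; map-cong; map-upTo)
open import Data.List.Relation.Binary.Permutation.Propositional using (_↭_; ↭-refl; ↭-sym; ↭-trans; ↭-reflexive; ↭⇒↭ₛ; prep; module PermutationReasoning)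
open import Data.List.Relation.Binary.Permutation.Propositional.Properties using (++-comm; ++-commutativeMonoid; ∈-resp-↭; ↭-reverse; shift) renaming (++⁺ to ++⁺-↭; map⁺ to map⁺-↭)
open import Data.List.Relation.Binary.Permutation.Setoid.Properties using (Unique-resp-↭)
open import Data.List.Relation.Binary.Pointwise using (Pointwise; []; _∷_)
open import Data.List.Relation.Binary.Sublist.DecPropositional using (_⊆?_)
open import Data.List.Relation.Binary.Sublist.Propositional using (_⊆_; []; _∷_; _∷ʳ_; ⊆-refl; ⊆-trans; from∈; to∈)
open import Data.List.Relation.Binary.Sublist.Propositional.Properties using (++⁺; ++⁺ˡ; ++⁺ʳ; reverse⁺; ∷ˡ⁻) renaming (map⁺ to map⁺-⊆)
open import Data.List.Relation.Unary.All as All using (All; []; _∷_; all?)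
open import Data.List.Relation.Unary.All.Properties using (take⁺; All¬⇒¬Any) renaming (map⁺ to map⁺-All; ++⁺ to ++⁺-All)
open import Data.List.Relation.Unary.AllPairs using ([]; _∷_)
open import Data.List.Relation.Unary.Any using (Any; here; there)
import Data.List.Relation.Unary.Any.Properties as Any
open import Data.List.Relation.Unary.Unique.Propositional using (Unique)
import Data.List.Relation.Unary.Unique.Propositional.Properties as Unique
import Data.List.Membership.DecPropositional as DecMembership
open import Data.List.Sort.Base using (SortingAlgorithm)
open import Data.List.Sort.MergeSort using (mergeSort)
open import Data.Nat using (ℕ; zero; suc; _+_; _*_; _∸_; _^_; _/_; _%_; _≤_; _<_; _≟_; z≤n; s≤s; z<s; s≤s⁻¹)
open import Data.Nat.Divisibility using (_∣_; _∣?_; ∣m+n∣m⇒∣n; ∣m∣n⇒∣m+n; m∣m*n; ∣1⇒≡1)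
open import Data.Nat.DivMod using (m≡m%n+[m/n]*n; m%n<n; m<n*o⇒m/o<n; m/n*n≤m)
open import Data.Nat.Properties
open import Data.Nat.Solver using (module +-*-Solver)
import Algebra.Solver.CommutativeMonoid as CommutativeMonoidSolver
open import Data.Product using (_×_; _,_; proj₁; proj₂; ∃; ∃₂)
open import Data.Product.Properties using (≡-dec)
open import Data.Sum as Sum using (_⊎_; inj₁; inj₂; [_,_]′)
open import Function using (_∘_; id; _⇔_; mk⇔; Equivalence)
open import Relation.Binary.PropositionalEquality using (_≡_; _≢_; refl; sym; trans; cong; cong₂; subst; subst₂; ≢-sym; setoid; module ≡-Reasoning)
open import Relation.Binary.Definitions using (tri<; tri≈; tri>)
open import Relation.Nullary using (¬_; yes; no; ¬?; contradiction)
open import Relation.Nullary.Decidable using (from-yes; _×-dec_; _⊎-dec_)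

-- Counting how the rows of a matrix order a pair.

-- Counts are carried as row-by-row certificates, so that stacking, shifting and enlarging rows act
-- on them directly. They turn into values of `#precedes` in `tally⇒#precedes`, where uniqueness of
-- the entries makes the two orders exclusive.
data Tally (a b : ℕ) : Matrix → ℕ → ℕ → Set where
  []   : Tally a b [] 0 0
  win  : ∀ {u M x y} → a ∷ b ∷ [] ⊆ u → Tally a b M x y → Tally a b (u ∷ M) (suc x) y
  lose : ∀ {u M x y} → b ∷ a ∷ [] ⊆ u → Tally a b M x y → Tally a b (u ∷ M) x (suc y)

swap : ∀ {a b M x y} → Tally a b M x y → Tally b a M y x
swap []         = []
swap (win p t)  = lose p (swap t)
swap (lose p t) = win p (swap t)

infixr 5 _++ᵗ_

_++ᵗ_ : ∀ {a b M N x y x′ y′} → Tally a b M x y → Tally a b N x′ y′ →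
        Tally a b (M ++ N) (x + x′) (y + y′)
[]       ++ᵗ s = s
win p t  ++ᵗ s = win p (t ++ᵗ s)
lose p t ++ᵗ s = lose p (t ++ᵗ s)

enlarge : ∀ {a b M N x y} → Pointwise _⊆_ M N → Tally a b M x y → Tally a b N x y
enlarge []           []         = []
enlarge (u⊆w ∷ M⊆N) (win p t)  = win (⊆-trans p u⊆w) (enlarge M⊆N t)
enlarge (u⊆w ∷ M⊆N) (lose p t) = lose (⊆-trans p u⊆w) (enlarge M⊆N t)

tally-+𝟏· : ∀ c {a b M x y} → Tally a b M x y → Tally (a + c) (b + c) (M +𝟏· c) x y
tally-+𝟏· c []         = []
tally-+𝟏· c (win p t)  = win (map⁺-⊆ (_+ c) p) (tally-+𝟏· c t)
tally-+𝟏· c (lose p t) = lose (map⁺-⊆ (_+ c) p) (tally-+𝟏· c t)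

#-tally : ∀ {a b M x y} → Tally a b M x y → # M ≡ x + y
#-tally []         = refl
#-tally (win p t)  = cong suc (#-tally t)
#-tally {x = x} {suc y} (lose p t) = trans (cong suc (#-tally t)) (sym (+-suc x y))

-- The deleted row is either a win or a loss; the two bounds hold in both cases and suffice for a
-- lead of two.
tally-init : ∀ {a b M x y} → Tally a b M x y →
  ∃₂ λ x′ y′ → Tally a b (take (# M ∸ 1) M) x′ y′ × x ≤ suc x′ × y′ ≤ y
tally-init []                    = _ , _ , [] , z≤n , z≤n
tally-init (win _ [])            = _ , _ , [] , ≤-refl , z≤n
tally-init (lose _ [])           = _ , _ , [] , z≤n , z≤n
-- Matching on `t` exposes a second row, which lets `take` reduce past the first.
tally-init (win p t@(win _ _))   = let _ , _ , t′ , x≤ , y≤ = tally-init t in _ , _ , win p t′ , s≤s x≤ , y≤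
tally-init (win p t@(lose _ _))  = let _ , _ , t′ , x≤ , y≤ = tally-init t in _ , _ , win p t′ , s≤s x≤ , y≤
tally-init (lose p t@(win _ _))  = let _ , _ , t′ , x≤ , y≤ = tally-init t in _ , _ , lose p t′ , x≤ , s≤s y≤
tally-init (lose p t@(lose _ _)) = let _ , _ , t′ , x≤ , y≤ = tally-init t in _ , _ , lose p t′ , x≤ , s≤s y≤

-- As soon as one of the two subsequences uses the head of `u`, that entry is found again in the
-- tail.
⊆-asym : ∀ {a b : ℕ} {u} → Unique u → a ∷ b ∷ [] ⊆ u → ¬ (b ∷ a ∷ [] ⊆ u)
⊆-asym (_ ∷ !u)  (_ ∷ʳ p)   (_ ∷ʳ q)   = ⊆-asym !u p q
⊆-asym (c∉u ∷ _) (_ ∷ʳ p)   (refl ∷ _) = All¬⇒¬Any c∉u (to∈ (∷ˡ⁻ p))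
⊆-asym (c∉u ∷ _) (refl ∷ _) (_ ∷ʳ q)   = All¬⇒¬Any c∉u (to∈ (∷ˡ⁻ q))
⊆-asym (c∉u ∷ _) (refl ∷ p) (refl ∷ _) = All¬⇒¬Any c∉u (to∈ p)

tally⇒#precedes : ∀ {a b M x y} → All Unique M → Tally a b M x y →
                  #precedes a b M ≡ x × #precedes b a M ≡ y
tally⇒#precedes [] [] = refl , refl
tally⇒#precedes {a} {b} (!u ∷ !M) (win p t) =
  let eˣ , eʸ = tally⇒#precedes !M t in
  trans (cong length (filter-accept (λ u → _⊆?_ _≟_ (a ∷ b ∷ []) u) p)) (cong suc eˣ) ,
  trans (cong length (filter-reject (λ u → _⊆?_ _≟_ (b ∷ a ∷ []) u) (⊆-asym !u p))) eʸ
tally⇒#precedes {a} {b} (!u ∷ !M) (lose p t) =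
  let eˣ , eʸ = tally⇒#precedes !M t in
  trans (cong length (filter-reject (λ u → _⊆?_ _≟_ (a ∷ b ∷ []) u) (⊆-asym !u p))) eˣ ,
  trans (cong length (filter-accept (λ u → _⊆?_ _≟_ (b ∷ a ∷ []) u) p)) (cong suc eʸ)

∈-total : ∀ {a b : ℕ} {u} → a ≢ b → a ∈ u → b ∈ u → a ∷ b ∷ [] ⊆ u ⊎ b ∷ a ∷ [] ⊆ u
∈-total a≢b (here refl) (here refl) = contradiction refl a≢b
∈-total a≢b (here refl) (there b∈u) = inj₁ (refl ∷ from∈ b∈u)
∈-total a≢b (there a∈u) (here refl) = inj₂ (refl ∷ from∈ a∈u)
∈-total a≢b (there a∈u) (there b∈u) = Sum.map (_ ∷ʳ_) (_ ∷ʳ_) (∈-total a≢b a∈u b∈u)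

-- Serves the base profile: some tally exists, and its counts are identified afterwards by
-- evaluating `#precedes`.
tally : ∀ {a b M} → a ≢ b → All (a ∈_) M → All (b ∈_) M → ∃₂ (Tally a b M)
tally a≢b []          []          = _ , _ , []
tally a≢b (a∈u ∷ a∈M) (b∈u ∷ b∈M) with ∈-total a≢b a∈u b∈u | tally a≢b a∈M b∈M
... | inj₁ p | _ , _ , t = _ , _ , win p t
... | inj₂ p | _ , _ , t = _ , _ , lose p t

-- The bowtie of two profiles.

-- Certifies that both matrices have `2 * r` rows, in the two-row steps of `_⋈_`; on such pairs
-- `_⋈_` discards nothing.
data Balanced : ℕ → Matrix → Matrix → Set where
  []  : Balanced 0 [] []
  two : ∀ {r u₁ u₂ w₁ w₂ M N} → Balanced r M N →
        Balanced (suc r) (u₁ ∷ u₂ ∷ M) (w₁ ∷ w₂ ∷ N)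

⋈-balanced : ∀ {r M N} c → Balanced r M N → Balanced r (M ⋈ N) ((M ⋈ N) +𝟏· c)
⋈-balanced c []      = []
⋈-balanced c (two β) = two (⋈-balanced c β)

⋈-⊇ˡ : ∀ {r M N} → Balanced r M N → Pointwise _⊆_ M (M ⋈ N)
⋈-⊇ˡ []      = []
⋈-⊇ˡ (two {w₁ = w₁} {w₂} β) = ++⁺ʳ w₁ ⊆-refl ∷ ++⁺ˡ w₂ ⊆-refl ∷ ⋈-⊇ˡ β

⋈-⊇ʳ : ∀ {r M N} → Balanced r M N → Pointwise _⊆_ N (M ⋈ N)
⋈-⊇ʳ []      = []
⋈-⊇ʳ (two {u₁ = u₁} {u₂} β) = ++⁺ˡ u₁ ⊆-refl ∷ ++⁺ʳ u₂ ⊆-refl ∷ ⋈-⊇ʳ β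

-- Each pair of rows puts the `M` part first once and the `N` part first once.
⋈-tally : ∀ {r a b M N} → Balanced r M N → All (a ∈_) M → All (b ∈_) N → Tally a b (M ⋈ N) r r
⋈-tally []      []                  []                  = []
⋈-tally (two β) (a∈u₁ ∷ a∈u₂ ∷ a∈M) (b∈w₁ ∷ b∈w₂ ∷ b∈N) =
  win (++⁺ (from∈ a∈u₁) (from∈ b∈w₁)) (lose (++⁺ (from∈ b∈w₂) (from∈ a∈u₂)) (⋈-tally β a∈M b∈N))

⋈-profile : ∀ {r V W M N} → Balanced r M N → IsProfileOn V M → IsProfileOn W N →
            IsProfileOn (V ++ W) (M ⋈ N)
⋈-profile []      []               []               = []
⋈-profile {V = V} {W} (two β) (u₁↭V ∷ u₂↭V ∷ M↭V) (w₁↭W ∷ w₂↭W ∷ N↭W) =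
  ++⁺-↭ u₁↭V w₁↭W ∷ ↭-trans (++⁺-↭ w₂↭W u₂↭V) (++-comm W V) ∷ ⋈-profile β M↭V N↭W

-- Initial ranges, their halves, and their odd and even entries.

∈-range⁺ : ∀ {i m} → 0 < i → i ≤ m → i ∈ [1⋯ m ]
∈-range⁺ {suc i} _ i<m = ∈-map⁺ suc (∈-upTo⁺ i<m)

∈-range⁻ : ∀ {i m} → i ∈ [1⋯ m ] → 0 < i × i ≤ m
∈-range⁻ i∈ with _ , j∈ , refl ← ∈-map⁻ suc i∈ = z<s , ∈-upTo⁻ j∈

unique-range : ∀ m → Unique [1⋯ m ]
unique-range m = Unique.map⁺ suc-injective (Unique.upTo⁺ m)

applyUpTo-+ : ∀ (f : ℕ → ℕ) m n → applyUpTo f (m + n) ≡ applyUpTo f m ++ applyUpTo (λ k → f (m + k)) n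
applyUpTo-+ f zero    n = refl
applyUpTo-+ f (suc m) n = cong (f 0 ∷_) (applyUpTo-+ (f ∘ suc) m n)

range-double : ∀ m → [1⋯ 2 * m ] ≡ [1⋯ m ] ++ map (_+ m) [1⋯ m ]
range-double m = begin
  [1⋯ 2 * m ]                                         ≡⟨ map-upTo suc (2 * m) ⟩
  applyUpTo suc (m + (m + 0))                         ≡⟨ cong (λ n → applyUpTo suc (m + n)) (+-identityʳ m) ⟩
  applyUpTo suc (m + m)                               ≡⟨ applyUpTo-+ suc m m ⟩
  applyUpTo suc m ++ applyUpTo (λ k → suc (m + k)) m  ≡⟨ cong₂ _++_ (map-upTo suc m) (map-upTo _ m) ⟨
  [1⋯ m ] ++ map (λ k → suc (m + k)) (upTo m)         ≡⟨ cong ([1⋯ m ] ++_) (map-cong (λ k → cong suc (+-comm m k)) (upTo m)) ⟩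
  [1⋯ m ] ++ map ((_+ m) ∘ suc) (upTo m)              ≡⟨ cong ([1⋯ m ] ++_) (map-∘ (upTo m)) ⟩
  [1⋯ m ] ++ map (_+ m) [1⋯ m ]                       ∎
  where open ≡-Reasoning

applyUpTo-deinterleave : ∀ (f : ℕ → ℕ) m →
  applyUpTo f (m * 2) ↭ applyUpTo (λ k → f (k * 2)) m ++ applyUpTo (λ k → f (suc (k * 2))) m
applyUpTo-deinterleave f zero    = ↭-refl
applyUpTo-deinterleave f (suc m) = prep (f 0) (↭-trans
  (prep (f 1) (applyUpTo-deinterleave (f ∘ suc ∘ suc) m))
  (↭-sym (shift (f 1) _ _)))

-- At `m = 2 ^ (n ∸ 2)` these are definitionally `A₁ n` and `A₂ n`.
odds evens : ℕ → Row
odds m  = map (λ k → 2 * k + 1) (upTo m)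
evens m = map (λ k → 2 * k + 2) (upTo m)

range-parity : ∀ m → odds m ++ evens m ↭ [1⋯ 2 * m ]
range-parity m = begin
  odds m ++ evens m
    ≡⟨ cong₂ _++_ (map-cong odd≡ (upTo m)) (map-cong even≡ (upTo m)) ⟩
  map (λ k → suc (k * 2)) (upTo m) ++ map (λ k → suc (suc (k * 2))) (upTo m)
    ≡⟨ cong₂ _++_ (map-upTo _ m) (map-upTo _ m) ⟩
  applyUpTo (λ k → suc (k * 2)) m ++ applyUpTo (λ k → suc (suc (k * 2))) m
    ↭⟨ applyUpTo-deinterleave suc m ⟨
  applyUpTo suc (m * 2)
    ≡⟨ map-upTo suc (m * 2) ⟨
  [1⋯ m * 2 ]
    ≡⟨ cong [1⋯_] (*-comm m 2) ⟩
  [1⋯ 2 * m ] ∎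
  where
  open PermutationReasoning
  odd≡ : ∀ k → 2 * k + 1 ≡ suc (k * 2)
  odd≡ k = trans (+-comm (2 * k) 1) (cong suc (*-comm 2 k))
  even≡ : ∀ k → 2 * k + 2 ≡ suc (suc (k * 2))
  even≡ k = trans (+-comm (2 * k) 2) (cong (suc ∘ suc) (*-comm 2 k))

-- The four added rows as concatenations of blocks.

-- Unlike concat, join leaves no trailing [], so that blockRows reduces to the
-- rows v₁ n, …, v₄ n as they are defined.
join : List Row → Row
join []           = []
join (x ∷ [])     = x
join (x ∷ y ∷ xs) = x ++ join (y ∷ xs)

infixr 5 _⌢_

-- A precedence certificate by position: both entries inside one block, or in two different blocks.
data InOrder (c d : ℕ) : List Row → Set where
  block : ∀ {x xs} → c ∷ d ∷ [] ⊆ x → InOrder c d (x ∷ xs)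
  _⌢_   : ∀ {x xs} → c ∈ x → Any (d ∈_) xs → InOrder c d (x ∷ xs)
  skip  : ∀ {x xs} → InOrder c d xs → InOrder c d (x ∷ xs)

∈-join : ∀ {c} xs → Any (c ∈_) xs → c ∈ join xs
∈-join (_ ∷ [])     (here c∈x) = c∈x
∈-join (x ∷ y ∷ xs) (here c∈x) = ∈-++⁺ˡ c∈x
∈-join (x ∷ y ∷ xs) (there p)  = ∈-++⁺ʳ x (∈-join (y ∷ xs) p)

inOrder : ∀ {c d} xs → InOrder c d xs → c ∷ d ∷ [] ⊆ join xs
inOrder (x ∷ [])     (block p)      = p
inOrder (x ∷ y ∷ xs) (block p)      = ++⁺ʳ (join (y ∷ xs)) p
inOrder (x ∷ y ∷ xs) (c∈x ⌢ d∈y∷xs) = ++⁺ (from∈ c∈x) (from∈ (∈-join (y ∷ xs) d∈y∷xs))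
inOrder (x ∷ y ∷ xs) (skip p)       = ++⁺ˡ x (inOrder (y ∷ xs) p)

-- The blocks are arbitrary: how these rows order a pair depends only on the blocks holding its
-- entries and, within one block, on the order there.
module BlockRows (a₁ a₂ b₁ b₂ : Row) where

  w₁ w₂ w₃ w₄ : List Row
  w₁ = a₁ ∷ b₁ ∷ a₂ ∷ b₂ ∷ []
  w₂ = reverse a₂ ∷ reverse b₂ ∷ reverse a₁ ∷ reverse b₁ ∷ []
  w₃ = b₁ ∷ a₂ ∷ b₂ ∷ a₁ ∷ []
  w₄ = reverse b₂ ∷ reverse a₁ ∷ reverse b₁ ∷ reverse a₂ ∷ []

  blockRows : Matrix
  blockRows = map join (w₁ ∷ w₂ ∷ w₃ ∷ w₄ ∷ [])

  blockRows-profile : IsProfileOn ((a₁ ++ a₂) ++ (b₁ ++ b₂)) blockRows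
  blockRows-profile =
    solve 4 (λ p q r s → p ⊕ r ⊕ q ⊕ s ⊜ (p ⊕ q) ⊕ (r ⊕ s)) ↭-refl a₁ a₂ b₁ b₂ ∷
    ↭-trans (++⁺-↭ (↭-reverse a₂) (++⁺-↭ (↭-reverse b₂) (++⁺-↭ (↭-reverse a₁) (↭-reverse b₁))))
      (solve 4 (λ p q r s → q ⊕ s ⊕ p ⊕ r ⊜ (p ⊕ q) ⊕ (r ⊕ s)) ↭-refl a₁ a₂ b₁ b₂) ∷
    solve 4 (λ p q r s → r ⊕ q ⊕ s ⊕ p ⊜ (p ⊕ q) ⊕ (r ⊕ s)) ↭-refl a₁ a₂ b₁ b₂ ∷
    ↭-trans (++⁺-↭ (↭-reverse b₂) (++⁺-↭ (↭-reverse a₁) (++⁺-↭ (↭-reverse b₁) (↭-reverse a₂))))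
      (solve 4 (λ p q r s → s ⊕ p ⊕ r ⊕ q ⊜ (p ⊕ q) ⊕ (r ⊕ s)) ↭-refl a₁ a₂ b₁ b₂) ∷ []
    where open CommutativeMonoidSolver (++-commutativeMonoid {A = ℕ})

  -- Every block is read forwards in the first and third rows and backwards in the other two, so a
  -- pair inside one block splits evenly.
  tally-a₁ : ∀ {i j} → i ∷ j ∷ [] ⊆ a₁ → Tally i j blockRows 2 2
  tally-a₁ p =
    win  (inOrder w₁ (block p)) (
    lose (inOrder w₂ (skip (skip (block (reverse⁺ p))))) (
    win  (inOrder w₃ (skip (skip (skip (block p))))) (
    lose (inOrder w₄ (skip (block (reverse⁺ p)))) [])))

  tally-a₂ : ∀ {i j} → i ∷ j ∷ [] ⊆ a₂ → Tally i j blockRows 2 2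
  tally-a₂ p =
    win  (inOrder w₁ (skip (skip (block p)))) (
    lose (inOrder w₂ (block (reverse⁺ p))) (
    win  (inOrder w₃ (skip (block p))) (
    lose (inOrder w₄ (skip (skip (skip (block (reverse⁺ p)))))) [])))

  tally-b₁ : ∀ {i j} → i ∷ j ∷ [] ⊆ b₁ → Tally i j blockRows 2 2
  tally-b₁ p =
    win  (inOrder w₁ (skip (block p))) (
    lose (inOrder w₂ (skip (skip (skip (block (reverse⁺ p)))))) (
    win  (inOrder w₃ (block p)) (
    lose (inOrder w₄ (skip (skip (block (reverse⁺ p))))) [])))

  tally-b₂ : ∀ {i j} → i ∷ j ∷ [] ⊆ b₂ → Tally i j blockRows 2 2
  tally-b₂ p =
    win  (inOrder w₁ (skip (skip (skip (block p))))) (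
    lose (inOrder w₂ (skip (block (reverse⁺ p)))) (
    win  (inOrder w₃ (skip (skip (block p)))) (
    lose (inOrder w₄ (block (reverse⁺ p))) [])))

  -- Block `a₁` leads in rows one and four, `a₂` in rows two and three. For `b₁` and `b₂` below, the
  -- leader alternates.
  tally-a₁a₂ : ∀ {i j} → i ∈ a₁ → j ∈ a₂ → Tally i j blockRows 2 2
  tally-a₁a₂ p q =
    win  (inOrder w₁ (p ⌢ there (here q))) (
    lose (inOrder w₂ (Any.reverse⁺ q ⌢ there (here (Any.reverse⁺ p)))) (
    lose (inOrder w₃ (skip (q ⌢ there (here p)))) (
    win  (inOrder w₄ (skip (Any.reverse⁺ p ⌢ there (here (Any.reverse⁺ q))))) [])))

  tally-b₁b₂ : ∀ {i j} → i ∈ b₁ → j ∈ b₂ → Tally i j blockRows 2 2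
  tally-b₁b₂ p q =
    win  (inOrder w₁ (skip (p ⌢ there (here q)))) (
    lose (inOrder w₂ (skip (Any.reverse⁺ q ⌢ there (here (Any.reverse⁺ p))))) (
    win  (inOrder w₃ (p ⌢ there (here q))) (
    lose (inOrder w₄ (Any.reverse⁺ q ⌢ there (here (Any.reverse⁺ p)))) [])))

  -- Block `b₁` directly follows `a₁` except in the third row, where `a₁` is moved to the end; for
  -- `a₂` and `b₂` the exception is the fourth row.
  tally-a₁b₁ : ∀ {i j} → i ∈ a₁ → j ∈ b₁ → Tally i j blockRows 3 1
  tally-a₁b₁ p q =
    win  (inOrder w₁ (p ⌢ here q)) (
    win  (inOrder w₂ (skip (skip (Any.reverse⁺ p ⌢ here (Any.reverse⁺ q))))) (
    lose (inOrder w₃ (q ⌢ there (there (here p)))) (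
    win  (inOrder w₄ (skip (Any.reverse⁺ p ⌢ here (Any.reverse⁺ q)))) [])))

  tally-a₂b₂ : ∀ {i j} → i ∈ a₂ → j ∈ b₂ → Tally i j blockRows 3 1
  tally-a₂b₂ p q =
    win  (inOrder w₁ (skip (skip (p ⌢ here q)))) (
    win  (inOrder w₂ (Any.reverse⁺ p ⌢ here (Any.reverse⁺ q))) (
    win  (inOrder w₃ (skip (p ⌢ here q))) (
    lose (inOrder w₄ (Any.reverse⁺ q ⌢ there (there (here (Any.reverse⁺ p))))) [])))

  -- Block `a₁` is ahead of `b₂` in the first row only, and `a₂` is ahead of `b₁` in the second row
  -- only.
  tally-a₁b₂ : ∀ {i j} → i ∈ a₁ → j ∈ b₂ → Tally i j blockRows 1 3
  tally-a₁b₂ p q =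
    win  (inOrder w₁ (p ⌢ there (there (here q)))) (
    lose (inOrder w₂ (skip (Any.reverse⁺ q ⌢ here (Any.reverse⁺ p)))) (
    lose (inOrder w₃ (skip (skip (q ⌢ here p)))) (
    lose (inOrder w₄ (Any.reverse⁺ q ⌢ here (Any.reverse⁺ p))) [])))

  tally-a₂b₁ : ∀ {i j} → i ∈ a₂ → j ∈ b₁ → Tally i j blockRows 1 3
  tally-a₂b₁ p q =
    lose (inOrder w₁ (skip (q ⌢ here p))) (
    win  (inOrder w₂ (Any.reverse⁺ p ⌢ there (there (here (Any.reverse⁺ q))))) (
    lose (inOrder w₃ (q ⌢ here p)) (
    lose (inOrder w₄ (skip (skip (Any.reverse⁺ q ⌢ here (Any.reverse⁺ p))))) [])))

  -- An even split is symmetric, so the order of `i` and `j` inside the block may remain unknown.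
  either : ∀ {i j xs} → (∀ {c d} → c ∷ d ∷ [] ⊆ xs → Tally c d blockRows 2 2) →
           i ≢ j → i ∈ xs → j ∈ xs → Tally i j blockRows 2 2
  either t i≢j i∈ j∈ = [ t , swap ∘ t ]′ (∈-total i≢j i∈ j∈)

  tally-a : ∀ {i j} → i ≢ j → i ∈ a₁ ++ a₂ → j ∈ a₁ ++ a₂ → Tally i j blockRows 2 2
  tally-a i≢j i∈ j∈ with ∈-++⁻ a₁ i∈ | ∈-++⁻ a₁ j∈
  ... | inj₁ p | inj₁ q = either tally-a₁ i≢j p q
  ... | inj₁ p | inj₂ q = tally-a₁a₂ p q
  ... | inj₂ p | inj₁ q = swap (tally-a₁a₂ q p)
  ... | inj₂ p | inj₂ q = either tally-a₂ i≢j p q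

  tally-b : ∀ {i j} → i ≢ j → i ∈ b₁ ++ b₂ → j ∈ b₁ ++ b₂ → Tally i j blockRows 2 2
  tally-b i≢j i∈ j∈ with ∈-++⁻ b₁ i∈ | ∈-++⁻ b₁ j∈
  ... | inj₁ p | inj₁ q = either tally-b₁ i≢j p q
  ... | inj₁ p | inj₂ q = tally-b₁b₂ p q
  ... | inj₂ p | inj₁ q = swap (tally-b₁b₂ q p)
  ... | inj₂ p | inj₂ q = either tally-b₂ i≢j p q

-- Parity, and the block rows at a fixed level of the recursion.

Odd : ℕ → Set
Odd i = ∃ λ k → i ≡ 2 * k + 1

odd⇒¬2∣ : ∀ {i} → Odd i → ¬ 2 ∣ i
odd⇒¬2∣ (k , refl) 2∣i with () ← ∣1⇒≡1 (∣m+n∣m⇒∣n 2∣i (m∣m*n k))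

odd+odd : ∀ {i j} → Odd i → Odd j → 2 ∣ i + j
odd+odd (k , refl) (l , refl) = subst (2 ∣_) eq (m∣m*n (k + l + 1))
  where
  open +-*-Solver
  eq : 2 * (k + l + 1) ≡ (2 * k + 1) + (2 * l + 1)
  eq = solve 2 (λ k l → con 2 :* (k :+ l :+ con 1) := (con 2 :* k :+ con 1) :+ (con 2 :* l :+ con 1)) refl k l

odd-odds : ∀ m {i} → i ∈ odds m → Odd i
odd-odds m i∈ with k , _ , eq ← ∈-map⁻ _ i∈ = k , eq

even-evens : ∀ m {i} → i ∈ evens m → 2 ∣ i
even-evens m i∈ with k , _ , refl ← ∈-map⁻ _ i∈ = ∣m∣n⇒∣m+n (m∣m*n k) (m∣m*n 1)

module Level (k : ℕ) where

  n half : ℕ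
  n    = 4 + k
  half = 2 ^ (3 + k)

  V low high : Row
  V    = [1⋯ 2 ^ n ]
  low  = [1⋯ half ]
  high = map (_+ half) low

  V≡low++high : V ≡ low ++ high
  V≡low++high = range-double half

  low↭ : A₁ n ++ A₂ n ↭ low
  low↭ = range-parity (2 ^ (2 + k))

  high↭ : B₁ n ++ B₂ n ↭ high
  high↭ = begin
    B₁ n ++ B₂ n                                        ≡⟨ cong₂ _++_ B₁≡ B₂≡ ⟩
    map (_+ half) (A₁ n) ++ map (_+ half) (A₂ n)        ≡⟨ map-++ (_+ half) (A₁ n) (A₂ n) ⟨
    map (_+ half) (A₁ n ++ A₂ n)                        ↭⟨ map⁺-↭ (_+ half) low↭ ⟩
    high                                                ∎
    where
    open PermutationReasoning
    B₁≡ : B₁ n ≡ map (_+ half) (A₁ n)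
    B₁≡ = trans (map-cong (λ k → +-comm half (2 * k + 1)) (upTo _)) (map-∘ (upTo _))
    B₂≡ : B₂ n ≡ map (_+ half) (A₂ n)
    B₂≡ = trans (map-cong (λ k → +-comm half (2 * k + 2)) (upTo _)) (map-∘ (upTo _))

  open BlockRows (A₁ n) (A₂ n) (B₁ n) (B₂ n) public renaming (blockRows to vs)

  vs-profile : IsProfileOn (low ++ high) vs
  vs-profile = All.map (λ p → ↭-trans p (++⁺-↭ low↭ high↭)) blockRows-profile

  vs-low : ∀ {i j} → i ≢ j → i ∈ low → j ∈ low → Tally i j vs 2 2
  vs-low i≢j i∈ j∈ = tally-a i≢j (∈-resp-↭ (↭-sym low↭) i∈) (∈-resp-↭ (↭-sym low↭) j∈)

  vs-high : ∀ {i j} → i ≢ j → i ∈ high → j ∈ high → Tally i j vs 2 2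
  vs-high i≢j i∈ j∈ = tally-b i≢j (∈-resp-↭ (↭-sym high↭) i∈) (∈-resp-↭ (↭-sym high↭) j∈)

  -- Since `half` is twice `2 ^ (2 + k)`, adding it preserves parity.
  odd-B₁ : ∀ {j} → j ∈ B₁ n → Odd j
  odd-B₁ j∈ with l , _ , refl ← ∈-map⁻ _ j∈ = 2 ^ (2 + k) + l ,
    trans (sym (+-assoc half (2 * l) 1)) (cong (_+ 1) (sym (*-distribˡ-+ 2 (2 ^ (2 + k)) l)))

  even-B₂ : ∀ {j} → j ∈ B₂ n → 2 ∣ j
  even-B₂ j∈ with l , _ , refl ← ∈-map⁻ _ j∈ =
    ∣m∣n⇒∣m+n (m∣m*n (2 ^ (2 + k))) (∣m∣n⇒∣m+n (m∣m*n l) (m∣m*n 1))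

  -- Blocks with index 1 hold the odd entries and those with index 2 the even ones, so the sum is
  -- even exactly when the indices agree.
  vs-cross : ∀ {i j} → i ∈ low → j ∈ high →
    (2 ∣ i + j × Tally i j vs 3 1) ⊎ (¬ 2 ∣ i + j × Tally i j vs 1 3)
  vs-cross {i} {j} i∈ j∈
    with ∈-++⁻ (A₁ n) (∈-resp-↭ (↭-sym low↭) i∈) | ∈-++⁻ (B₁ n) (∈-resp-↭ (↭-sym high↭) j∈)
  ... | inj₁ p | inj₁ q = inj₁ (odd+odd (odd-odds _ p) (odd-B₁ q) , tally-a₁b₁ p q)
  ... | inj₂ p | inj₂ q = inj₁ (∣m∣n⇒∣m+n (even-evens _ p) (even-B₂ q) , tally-a₂b₂ p q)
  ... | inj₁ p | inj₂ q = inj₂ (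
    (λ 2∣i+j → odd⇒¬2∣ (odd-odds _ p) (∣m+n∣m⇒∣n (subst (2 ∣_) (+-comm i j) 2∣i+j) (even-B₂ q))) ,
    tally-a₁b₂ p q)
  ... | inj₂ p | inj₁ q = inj₂ (
    (λ 2∣i+j → odd⇒¬2∣ (odd-B₁ q) (∣m+n∣m⇒∣n 2∣i+j (even-evens _ p))) ,
    tally-a₂b₁ p q)

-- The base profile and its graph, checked by evaluation.

-- Each row is a permutation of its sorted form, and sorting evaluates to `[1⋯ 8 ]`.
R₃-profile : IsProfileOn [1⋯ 8 ] R₃
R₃-profile = All.map (λ {u} eq → ↭-trans (↭-sym (sort-↭ u)) (↭-reflexive eq))
  (refl ∷ refl ∷ refl ∷ refl ∷ refl ∷ refl ∷ refl ∷ refl ∷ refl ∷ refl ∷ [])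
  where open SortingAlgorithm (mergeSort ≤-decTotalOrder)

members : ∀ {V M a} → IsProfileOn V M → a ∈ V → All (a ∈_) M
members M↭V a∈V = All.map (λ u↭V → ∈-resp-↭ (↭-sym u↭V) a∈V) M↭V

profile⇒unique : ∀ {V M} → Unique V → IsProfileOn V M → All Unique M
profile⇒unique !V = All.map (λ u↭V → Unique-resp-↭ (setoid ℕ) (↭⇒↭ₛ (↭-sym u↭V)) !V)

E₃-tallies : All (λ (i , j) → #precedes i j R₃ ≡ 6 × #precedes j i R₃ ≡ 4) E₃
E₃-tallies = from-yes (all? (λ (i , j) → (#precedes i j R₃ ≟ 6) ×-dec (#precedes j i R₃ ≟ 4)) E₃)

E₃-bounds : All (λ (i , j) → (0 < i × i ≤ 8) × (0 < j × j ≤ 8) × i ≢ j) E₃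
E₃-bounds = from-yes (all? (λ (i , j) →
  ((0 <? i) ×-dec (i ≤? 8)) ×-dec ((0 <? j) ×-dec (j ≤? 8)) ×-dec ¬? (i ≟ j)) E₃)

E₃-total : ∀ {i j} → i ∈ [1⋯ 8 ] → j ∈ [1⋯ 8 ] → i ≢ j → (i , j) ∈ E₃ ⊎ (j , i) ∈ E₃
E₃-total i∈ j∈ i≢j = [ (λ eq → contradiction eq i≢j) , id ]′ (All.lookup (All.lookup table i∈) j∈)
  where
  open DecMembership (≡-dec _≟_ _≟_) using (_∈?_)
  table : All (λ i → All (λ j → i ≡ j ⊎ (i , j) ∈ E₃ ⊎ (j , i) ∈ E₃) [1⋯ 8 ]) [1⋯ 8 ]
  table = from-yes (all? (λ i → all? (λ j → (i ≟ j) ⊎-dec ((i , j) ∈? E₃) ⊎-dec ((j , i) ∈? E₃)) [1⋯ 8 ]) [1⋯ 8 ])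

-- A level-independent description of the arrows.

-- The arrows of all G n at once: every G n is the restriction of Beats to
-- its vertices.
data Beats : ℕ → ℕ → Set where
  within : ∀ q {a b i j} → (a , b) ∈ E₃ → i ≡ a + 8 * q → j ≡ b + 8 * q → Beats i j
  even   : ∀ q {i j} → i ≤ 8 * q → 8 * q < j → 2 ∣ i + j → Beats i j
  odd    : ∀ q {i j} → i ≤ 8 * q → 8 * q < j → ¬ 2 ∣ i + j → Beats j i

class-end : ∀ {a q m} → a ≤ 8 → q < m → a + 8 * q ≤ 8 * m
class-end {a} {q} {m} a≤8 q<m = begin
  a + 8 * q   ≤⟨ +-monoˡ-≤ (8 * q) a≤8 ⟩
  8 + 8 * q   ≡⟨ *-suc 8 q ⟨
  8 * suc q   ≤⟨ *-monoʳ-≤ 8 q<m ⟩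
  8 * m       ∎
  where open ≤-Reasoning

-- The truncated difference is exact: `i + 8 * m ≤ 8 * q` forces `8 * m ≤ 8 * q`.
window : ∀ m q {i j} → i + 8 * m ≤ 8 * q → 8 * q < j + 8 * m → i ≤ 8 * (q ∸ m) × 8 * (q ∸ m) < j
window m q {i} {j} i≤ <j rewrite *-distribˡ-∸ 8 q m =
  m+n≤o⇒m≤o∸n i i≤ ,
  +-cancelʳ-< (8 * m) (8 * q ∸ 8 * m) j (≤-<-trans (≤-reflexive (m∸n+n≡m (m+n≤o⇒n≤o i i≤))) <j)

2∣-shift : ∀ m i j → 2 ∣ i + j ⇔ 2 ∣ (i + 8 * m) + (j + 8 * m)
2∣-shift m i j = mk⇔
  (λ 2∣i+j → subst (2 ∣_) eq (∣m∣n⇒∣m+n (m∣m*n (8 * m)) 2∣i+j))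
  (λ 2∣shifted → ∣m+n∣m⇒∣n (subst (2 ∣_) (sym eq) 2∣shifted) (m∣m*n (8 * m)))
  where
  open +-*-Solver
  eq : 2 * (8 * m) + (i + j) ≡ (i + 8 * m) + (j + 8 * m)
  eq = solve 3 (λ m i j → con 2 :* (con 8 :* m) :+ (i :+ j) := (i :+ con 8 :* m) :+ (j :+ con 8 :* m)) refl m i j

-- Translation by a multiple of 8 carries classes to classes and changes the sum by an even amount.
-- This brings arrows of the upper half down to the previous level.
shift-down : ∀ m {i j} → 0 < i → 0 < j → Beats (i + 8 * m) (j + 8 * m) → Beats i j
shift-down m {i} {j} 0<i 0<j (within q {a} {b} ab∈E₃ i≡ j≡) =
  within (q ∸ m) ab∈E₃ (cancel a i≡) (cancel b j≡)
  where
  m≤q : m ≤ q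
  -- Otherwise the class of `i + 8 * m` would end by `8 * m`, against `0 < i`.
  m≤q = ≮⇒≥ λ q<m → <⇒≢ (≤-<-trans
    (class-end (proj₂ (proj₁ (All.lookup E₃-bounds ab∈E₃))) q<m)
    (m<n+m (8 * m) 0<i)) (sym i≡)
  cancel : ∀ c {d} → d + 8 * m ≡ c + 8 * q → d ≡ c + 8 * (q ∸ m)
  cancel c {d} eq = +-cancelʳ-≡ (8 * m) d (c + 8 * (q ∸ m)) (begin
    d + 8 * m                   ≡⟨ eq ⟩
    c + 8 * q                   ≡⟨ cong (λ x → c + 8 * x) (m∸n+n≡m m≤q) ⟨
    c + 8 * (q ∸ m + m)         ≡⟨ cong (c +_) (*-distribˡ-+ 8 (q ∸ m) m) ⟩
    c + (8 * (q ∸ m) + 8 * m)   ≡⟨ +-assoc c _ _ ⟨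
    c + 8 * (q ∸ m) + 8 * m     ∎)
    where open ≡-Reasoning
shift-down m {i} {j} _ _ (even q i≤ <j 2∣) =
  let i≤′ , <j′ = window m q i≤ <j in even (q ∸ m) i≤′ <j′ (Equivalence.from (2∣-shift m i j) 2∣)
shift-down m {i} {j} _ _ (odd q j≤ <i ¬2∣) =
  let j≤′ , <i′ = window m q j≤ <i in odd (q ∸ m) j≤′ <i′ (¬2∣ ∘ Equivalence.to (2∣-shift m j i))

-- From `0 < a` and `i ≤ 8 * m` follows `q < m`, so the whole class ends by `8 * m`.
same-side : ∀ {m q a b i j} → 0 < a → b ≤ 8 → i ≡ a + 8 * q → j ≡ b + 8 * q → i ≤ 8 * m → j ≤ 8 * m
same-side {m} {q} 0<a b≤8 refl refl i≤ = class-end b≤8 (*-cancelˡ-< 8 q m (<-≤-trans (m<n+m (8 * q) 0<a) i≤))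

-- Only `even` is possible: no class straddles a multiple of 8, and `odd` would give `j < i`.
cross-even : ∀ m {i j} → i ≤ 8 * m → 8 * m < j → Beats i j → 2 ∣ i + j
cross-even m i≤ <j (within q ab∈E₃ i≡ j≡) =
  let (0<a , _) , (_ , b≤8) , _ = All.lookup E₃-bounds ab∈E₃ in
  contradiction (same-side {m} {q} 0<a b≤8 i≡ j≡ i≤) (<⇒≱ <j)
cross-even m i≤ <j (even _ _ _ 2∣)      = 2∣
cross-even m i≤ <j (odd _ j≤ <i _)      = contradiction (≤-<-trans j≤ <i) (<⇒≯ (≤-<-trans i≤ <j))

cross-odd : ∀ m {i j} → i ≤ 8 * m → 8 * m < j → Beats j i → ¬ 2 ∣ i + j
cross-odd m i≤ <j (within q ba∈E₃ j≡ i≡) =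
  let (_ , b≤8) , (0<a , _) , _ = All.lookup E₃-bounds ba∈E₃ in
  contradiction (same-side {m} {q} 0<a b≤8 i≡ j≡ i≤) (<⇒≱ <j)
cross-odd m i≤ <j (even _ j≤ <i _)      = contradiction (≤-<-trans j≤ <i) (<⇒≯ (≤-<-trans i≤ <j))
cross-odd m i≤ <j (odd _ _ _ ¬2∣)       = ¬2∣

Beats⇒≢ : ∀ {i j} → Beats i j → i ≢ j
Beats⇒≢ (within q ab∈E₃ refl refl) eq =
  proj₂ (proj₂ (All.lookup E₃-bounds ab∈E₃)) (+-cancelʳ-≡ (8 * q) _ _ eq)
Beats⇒≢ (even _ i≤ <j _) = <⇒≢ (≤-<-trans i≤ <j)
Beats⇒≢ (odd _ j≤ <i _)  = ≢-sym (<⇒≢ (≤-<-trans j≤ <i))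

one-class : ∀ q → 8 * q < 8 → 8 * q ≡ 0
one-class zero    _  = refl
one-class (suc q) lt = contradiction (*-monoʳ-≤ 8 (s≤s (z≤n {q}))) (<⇒≱ lt)

-- Up to 8 there is a single class, and the only class boundary below an entry is 0, which has no
-- positive entry on its other side.
Beats⇒E₃ : ∀ {i j} → 0 < i → i ≤ 8 → 0 < j → j ≤ 8 → Beats i j → (i , j) ∈ E₃
Beats⇒E₃ _ _ _ _ (within zero {a} {b} ab∈E₃ refl refl) =
  subst (_∈ E₃) (cong₂ _,_ (sym (+-identityʳ a)) (sym (+-identityʳ b))) ab∈E₃
Beats⇒E₃ _ i≤8 _ _ (within (suc q) ab∈E₃ refl refl) =
  let (0<a , _) , _ = All.lookup E₃-bounds ab∈E₃ in
  contradiction (≤-trans (+-mono-≤ 0<a (*-monoʳ-≤ 8 (s≤s (z≤n {q})))) i≤8) (<⇒≱ ≤-refl)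
Beats⇒E₃ 0<i _ _ j≤8 (even q i≤ <j _) =
  contradiction (<-≤-trans 0<i (≤-trans i≤ (≤-reflexive (one-class q (<-≤-trans <j j≤8))))) λ ()
Beats⇒E₃ _ i≤8 0<j _ (odd q j≤ <i _) =
  contradiction (<-≤-trans 0<j (≤-trans j≤ (≤-reflexive (one-class q (<-≤-trans <i i≤8))))) λ ()

-- Size, rows and counts of the recursive profiles.

-- Five pairs of rows at the base and two more pairs, `v₁` to `v₄`, per level: with n = 3 + k this
-- is 4n - 2 rows.
balanced-R : ∀ k c → Balanced (5 + k * 2) (R (3 + k)) (R (3 + k) +𝟏· c)
balanced-R zero    c = two (two (two (two (two []))))
balanced-R (suc k) c = two (two (⋈-balanced c (balanced-R k (2 ^ (3 + k)))))

profile-+𝟏· : ∀ {V M} c → IsProfileOn V M → IsProfileOn (map (_+ c) V) (M +𝟏· c)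
profile-+𝟏· c = map⁺-All ∘ All.map (map⁺-↭ (_+ c))

profile-R : ∀ k → IsProfileOn [1⋯ 2 ^ (3 + k) ] (R (3 + k))
profile-R zero    = R₃-profile
profile-R (suc k) = subst (λ V → IsProfileOn V (R (4 + k))) (sym V≡low++high)
  (++⁺-All vs-profile (⋈-profile (balanced-R k half) (profile-R k) (profile-+𝟏· half (profile-R k))))
  where open Level k

unique-R : ∀ k → All Unique (R (3 + k))
unique-R k = profile⇒unique (unique-range (2 ^ (3 + k))) (profile-R k)

E₃-tally : ∀ {i j} → i ∈ [1⋯ 8 ] → j ∈ [1⋯ 8 ] → (i , j) ∈ E₃ → Tally i j R₃ 6 4
E₃-tally i∈ j∈ ij∈E₃ =
  let _ , _ , i≢j = All.lookup E₃-bounds ij∈E₃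
      x≡6 , y≡4   = All.lookup E₃-tallies ij∈E₃
      _ , _ , t   = tally i≢j (members R₃-profile i∈) (members R₃-profile j∈)
      ≡x , ≡y     = tally⇒#precedes (unique-R 0) t
  in subst₂ (Tally _ _ R₃) (trans (sym ≡x) x≡6) (trans (sym ≡y) y≡4) t

2^[3+k]≡8*2^k : ∀ k → 2 ^ (3 + k) ≡ 8 * 2 ^ k
2^[3+k]≡8*2^k = ^-distribˡ-+-* 2 3

-- With n = 3 + k the counts are 2n and 2n - 2; in the form `k * 2` they grow by two per level by
-- computation.
tally-R : ∀ k {i j} → i ∈ [1⋯ 2 ^ (3 + k) ] → j ∈ [1⋯ 2 ^ (3 + k) ] → Beats i j →
          Tally i j (R (3 + k)) (6 + k * 2) (4 + k * 2)
tally-R zero i∈ j∈ β =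
  let 0<i , i≤8 = ∈-range⁻ i∈ ; 0<j , j≤8 = ∈-range⁻ j∈ in E₃-tally i∈ j∈ (Beats⇒E₃ 0<i i≤8 0<j j≤8 β)
tally-R (suc k) {i} {j} i∈ j∈ β = cases (split i∈) (split j∈)
  where
  open Level k

  split : ∀ {i} → i ∈ V → i ∈ low ⊎ i ∈ high
  split i∈ = ∈-++⁻ low (subst (_ ∈_) V≡low++high i∈)

  ⋈-R : Balanced (5 + k * 2) (R (3 + k)) (R (3 + k) +𝟏· half)
  ⋈-R = balanced-R k half

  low-≤ : ∀ {i} → i ∈ low → i ≤ 8 * 2 ^ k
  low-≤ {i} i∈ = subst (i ≤_) (2^[3+k]≡8*2^k k) (proj₂ (∈-range⁻ i∈))

  high-> : ∀ {j} → j ∈ high → 8 * 2 ^ k < j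
  high-> j∈ with l , l∈ , refl ← ∈-map⁻ (_+ half) j∈ =
    subst (_< l + half) (2^[3+k]≡8*2^k k) (m<n+m half (proj₁ (∈-range⁻ l∈)))

  across : ∀ {i j} → i ∈ low → j ∈ high →
    Tally i j (R (3 + k) ⋈ (R (3 + k) +𝟏· half)) (5 + k * 2) (5 + k * 2)
  across i∈ j∈ = ⋈-tally ⋈-R (members (profile-R k) i∈) (members (profile-+𝟏· half (profile-R k)) j∈)

  cases : i ∈ low ⊎ i ∈ high → j ∈ low ⊎ j ∈ high → Tally i j (R (4 + k)) (8 + k * 2) (6 + k * 2)
  cases (inj₁ i∈) (inj₁ j∈) = vs-low (Beats⇒≢ β) i∈ j∈ ++ᵗ enlarge (⋈-⊇ˡ ⋈-R) (tally-R k i∈ j∈ β)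
  -- Both entries are shifted copies: the arrow is moved down for the induction hypothesis, and the
  -- resulting tally is moved back up.
  cases (inj₂ i∈) (inj₂ j∈) with i′ , i′∈ , refl ← ∈-map⁻ (_+ half) i∈ | j′ , j′∈ , refl ← ∈-map⁻ (_+ half) j∈ =
    vs-high (Beats⇒≢ β) i∈ j∈ ++ᵗ enlarge (⋈-⊇ʳ ⋈-R) (tally-+𝟏· half (tally-R k i′∈ j′∈
      (shift-down (2 ^ k) (proj₁ (∈-range⁻ i′∈)) (proj₁ (∈-range⁻ j′∈))
        (subst (λ h → Beats (i′ + h) (j′ + h)) (2^[3+k]≡8*2^k k) β))))
  -- Adding 3 : 1 to the even split of the bowtie, `5 + k * 2` each, gives the required counts; the
  -- other parity contradicts the arrow.
  cases (inj₁ i∈) (inj₂ j∈) with vs-cross i∈ j∈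
  ... | inj₁ (_ , t)   = t ++ᵗ across i∈ j∈
  ... | inj₂ (¬2∣ , _) = contradiction (cross-even (2 ^ k) (low-≤ i∈) (high-> j∈) β) ¬2∣
  cases (inj₂ i∈) (inj₁ j∈) with vs-cross j∈ i∈
  ... | inj₁ (2∣ , _)  = contradiction 2∣ (cross-odd (2 ^ k) (low-≤ j∈) (high-> i∈) β)
  ... | inj₂ (_ , t)   = swap (t ++ᵗ across j∈ i∈)

-- Classes, and the arrows of the graphs in terms of them.

-- For different classes `i < j` forces `p < q`, so the end of class `p` is a boundary between the
-- two entries.
∈C-separated : ∀ {p q i j} → p ≢ q → i ∈C p → j ∈C q → i < j → i ≤ 8 * p × 8 * p < j
∈C-separated {p} {q} p≢q (<i , i≤) (<j , j≤) i<j with <-cmp p q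
... | tri< p<q _ _ = i≤ , ≤-<-trans (*-monoʳ-≤ 8 (∸-monoˡ-≤ 1 p<q)) <j
... | tri≈ _ p≡q _ = contradiction p≡q p≢q
... | tri> _ _ q<p = contradiction i<j (<⇒≯ (≤-<-trans (≤-trans j≤ (*-monoʳ-≤ 8 (∸-monoˡ-≤ 1 q<p))) <i))

∈C⇒∈range : ∀ k {q i} → q ∈ [1⋯ 2 ^ k ] → i ∈C q → i ∈ [1⋯ 2 ^ (3 + k) ]
∈C⇒∈range k {q} {i} q∈ (<i , i≤) = ∈-range⁺ (≤-<-trans z≤n <i)
  (subst (i ≤_) (sym (2^[3+k]≡8*2^k k)) (≤-trans i≤ (*-monoʳ-≤ 8 (proj₂ (∈-range⁻ q∈)))))

E⇒Beats : ∀ k {i j} → E (3 + k) i j →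
          i ∈ [1⋯ 2 ^ (3 + k) ] × j ∈ [1⋯ 2 ^ (3 + k) ] × Beats i j
E⇒Beats zero {i} {j} ij∈E₃ =
  let (0<i , i≤8) , (0<j , j≤8) , _ = All.lookup E₃-bounds ij∈E₃ in
  ∈-range⁺ 0<i i≤8 , ∈-range⁺ 0<j j≤8 , within 0 ij∈E₃ (sym (+-identityʳ i)) (sym (+-identityʳ j))
E⇒Beats (suc k) (sameClass {q} q∈ i∈C j∈C e) =
  ∈C⇒∈range (suc k) q∈ i∈C , ∈C⇒∈range (suc k) q∈ j∈C ,
  -- `within` numbers the classes from 0, `_∈C_` from 1.
  within (q ∸ 1) e (sym (m∸n+n≡m (<⇒≤ (proj₁ i∈C)))) (sym (m∸n+n≡m (<⇒≤ (proj₁ j∈C))))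
E⇒Beats (suc k) (evenSum {p} p∈ q∈ p≢q i∈C j∈C i<j 2∣) =
  let i≤ , <j = ∈C-separated p≢q i∈C j∈C i<j in
  ∈C⇒∈range (suc k) p∈ i∈C , ∈C⇒∈range (suc k) q∈ j∈C , even p i≤ <j 2∣
E⇒Beats (suc k) (oddSum {p} p∈ q∈ p≢q i∈C j∈C i<j ¬2∣) =
  let i≤ , <j = ∈C-separated p≢q i∈C j∈C i<j in
  ∈C⇒∈range (suc k) q∈ j∈C , ∈C⇒∈range (suc k) p∈ i∈C , odd p i≤ <j ¬2∣

class : ∀ m {i} → i ∈ [1⋯ 8 * m ] → ∃ λ q → q ∈ [1⋯ m ] × i ∈C q
class m {zero}  i∈ with () ← proj₁ (∈-range⁻ i∈)
-- The quotient is that of the predecessor, so that a multiple of 8 closes its class.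
class m {suc i} i∈ = suc (i / 8) , ∈-range⁺ z<s (m<n*o⇒m/o<n (subst (i <_) (*-comm 8 m) (proj₂ (∈-range⁻ i∈)))) ,
  s≤s (subst (_≤ i) (*-comm (i / 8) 8) (m/n*n≤m i 8)) , (begin
    suc i                       ≡⟨ cong suc (m≡m%n+[m/n]*n i 8) ⟩
    suc (i % 8) + i / 8 * 8     ≤⟨ +-monoˡ-≤ (i / 8 * 8) (m%n<n i 8) ⟩
    suc (i / 8) * 8             ≡⟨ *-comm (suc (i / 8)) 8 ⟩
    8 * suc (i / 8)             ∎)
  where open ≤-Reasoning

∈C-residue : ∀ q {i} → i ∈C q → i ∸ 8 * (q ∸ 1) ∈ [1⋯ 8 ]
-- The truncated `0 ∸ 1` makes class 0 empty.
∈C-residue zero    (<i , i≤) = contradiction <i (≤⇒≯ i≤)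
∈C-residue (suc q) {i} (<i , i≤) = ∈-range⁺ (m<n⇒0<n∸m <i)
  (m≤n+o⇒m∸n≤o i (8 * q) (subst (i ≤_) (trans (*-suc 8 q) (+-comm 8 (8 * q))) i≤))

E-total : ∀ k {i j} → i ∈ [1⋯ 2 ^ (3 + k) ] → j ∈ [1⋯ 2 ^ (3 + k) ] → i ≢ j →
          E (3 + k) i j ⊎ E (3 + k) j i
E-total zero i∈ j∈ i≢j = E₃-total i∈ j∈ i≢j
E-total (suc k) {i} {j} i∈ j∈ i≢j
  with p , p∈ , i∈C ← class (2 ^ suc k) (subst (λ m → i ∈ [1⋯ m ]) (2^[3+k]≡8*2^k (suc k)) i∈)
     | q , q∈ , j∈C ← class (2 ^ suc k) (subst (λ m → j ∈ [1⋯ m ]) (2^[3+k]≡8*2^k (suc k)) j∈)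
  with p ≟ q
... | yes refl = Sum.map (sameClass p∈ i∈C j∈C) (sameClass p∈ j∈C i∈C)
  (E₃-total (∈C-residue p i∈C) (∈C-residue p j∈C)
    (i≢j ∘ ∸-cancelʳ-≡ (<⇒≤ (proj₁ i∈C)) (<⇒≤ (proj₁ j∈C))))
... | no p≢q with <-cmp i j | 2 ∣? i + j
...   | tri< i<j _ _ | yes 2∣  = inj₁ (evenSum p∈ q∈ p≢q i∈C j∈C i<j 2∣)
...   | tri< i<j _ _ | no ¬2∣  = inj₂ (oddSum p∈ q∈ p≢q i∈C j∈C i<j ¬2∣)
...   | tri≈ _ i≡j _ | _       = contradiction i≡j i≢j
...   | tri> _ _ j<i | yes 2∣  = inj₂ (evenSum q∈ p∈ (≢-sym p≢q) j∈C i∈C j<i (subst (2 ∣_) (+-comm i j) 2∣))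
...   | tri> _ _ j<i | no ¬2∣  = inj₁ (oddSum q∈ p∈ (≢-sym p≢q) j∈C i∈C j<i (¬2∣ ∘ subst (2 ∣_) (+-comm j i)))

-- From counts to majority graphs.

-- A strict lead along every arrow suffices because the graph is a tournament: were a majority pair
-- not an arrow, its reverse would be one and would hold the majority.
generates-G : ∀ k {M} → IsProfileOn [1⋯ 2 ^ (3 + k) ] M →
  (∀ {i j} → E (3 + k) i j → ∃₂ λ x y → Tally i j M x y × y < x) → M generates G (3 + k)
generates-G k {M} M↭V majority = M↭V , λ i j → mk⇔ to from
  where
  V = [1⋯ 2 ^ (3 + k) ]

  2*-+ : ∀ x → 2 * x ≡ x + x
  2*-+ x = cong (x +_) (+-identityʳ x)

  wins : ∀ {i j x y} → Tally i j M x y → y < x → # M < 2 * #precedes i j M × 2 * #precedes j i M < # M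
  wins {x = x} {y} t y<x with ≡x , ≡y ← tally⇒#precedes (profile⇒unique (unique-range (2 ^ (3 + k))) M↭V) t
    -- With `x + y` rows in all, the goals become `x + y < x + x` and `y + y < x + y`.
    rewrite ≡x | ≡y | #-tally t | 2*-+ x | 2*-+ y = +-monoʳ-< x y<x , +-monoˡ-< y y<x

  to : ∀ {i j} → E (3 + k) i j → i ∈ V × j ∈ V × i ≢ j × # M < 2 * #precedes i j M
  to e = let i∈ , j∈ , β = E⇒Beats k e ; _ , _ , t , y<x = majority e in
    i∈ , j∈ , Beats⇒≢ β , proj₁ (wins t y<x)

  from : ∀ {i j} → i ∈ V × j ∈ V × i ≢ j × # M < 2 * #precedes i j M → E (3 + k) i j
  from (i∈ , j∈ , i≢j , #M<) with E-total k i∈ j∈ i≢j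
  ... | inj₁ e = e
  ... | inj₂ e = let _ , _ , t , y<x = majority e in contradiction #M< (<⇒≯ (proj₂ (wins t y<x)))

theorem3 : ∀ (n : ℕ) → 3 ≤ n →
    R n generates G n ×
    R̃ n generates G n ×
    (∀ i j → E n i j →
    #precedes i j (R n) ≡ 2 * n × #precedes j i (R n) ≡ 2 * n ∸ 2)
theorem3 (suc (suc (suc k))) (s≤s (s≤s (s≤s _))) =
  generates-G k (profile-R k) (λ e → _ , _ , E-tally e , m<n⇒m<1+n (n<1+n _)) ,
  generates-G k (take⁺ (# (R (3 + k)) ∸ 1) (profile-R k)) R̃-majority ,
  λ i j e → counts (tally⇒#precedes (unique-R k) (E-tally e))
  where
  E-tally : ∀ {i j} → E (3 + k) i j → Tally i j (R (3 + k)) (6 + k * 2) (4 + k * 2)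
  E-tally e = let i∈ , j∈ , β = E⇒Beats k e in tally-R k i∈ j∈ β

  R̃-majority : ∀ {i j} → E (3 + k) i j → ∃₂ λ x y → Tally i j (R̃ (3 + k)) x y × y < x
  R̃-majority e =
    let _ , _ , t , x≤ , y≤ = tally-init (E-tally e) in
    -- At least `5 + k * 2` wins remain, against at most `4 + k * 2` losses.
    _ , _ , t , ≤-<-trans y≤ (s≤s⁻¹ x≤)

  counts : ∀ {x y} → x ≡ 6 + k * 2 × y ≡ 4 + k * 2 → x ≡ 2 * (3 + k) × y ≡ 2 * (3 + k) ∸ 2
  counts (refl , refl) = *-comm (3 + k) 2 , cong (_∸ 2) (*-comm (3 + k) 2)
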